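{- For every priority channel system $S$, the structure $(\mathrm{Conf}_S,\to_{\#},\leq_{\#})$ is a well-structured transition system with stuttering compatibility; that is, $(\mathrm{Conf}_S,\leq_{\#})$ is a well-quasi-order, and whenever $C\to_{\#}D$ and $C\leq_{\#}C'$ there is a configuration $D'$ with $C'\to_{\#}^{+}D'$ and $D\leq_{\#}D'$.
   Context: For $d\in\mathbb{N}$ let $\Sigma_d=\{0,1,\ldots,d\}$. A level-$d$ priority channel system ($d$-PCS) is a tuple $S=(\Sigma_d,\mathrm{Ch},Q,\Delta)$ where $\mathrm{Ch}=\{c_1,\ldots,c_m\}$ is a finite set of channels, $Q$ is a finite set of control states, and $\Delta\subseteq Q\times \mathrm{Ch}\times\{!,?\}\times\Sigma_d\times Q$ is a set of rules, written $(q,c_i!a,q')$ (write) or $(q,c_i?a,q')$ (read). A priority channel system (PCS) is a $d$-PCS for some $d$. Configurations: $\mathrm{Conf}_S=Q\times(\Sigma_d^*)^m$. Reliable steps: a rule $(q,c_i?a,q')$ gives $(q,x_1,\ldots,x_m)\to(q',y_1,\ldots,y_m)$ if $x_i=a\,y_i$ and $x_j=y_j$ for $j\neq i$; a rule $(q,c_i!a,q')$ gives such a step if $y_i=x_i\,a$ and $x_j=y_j$ for $j\ne i$. Superseding on words: $x\to_{\#}y$ iff $x=a_1\cdots a_\ell$ and, for some $1\le k<\ell$, $a_k\le a_{k+1}$ and $y=a_1\cdots a_{k-1}a_{k+1}\cdots a_\ell$. The step relation $\to_{\#}$ on $\mathrm{Conf}_S$ consists of all reliable steps together with all internal superseding steps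 $(q,x_1,\ldots,x_m)\to_{\#}(q,y_1,\ldots,y_m)$ where $x_i\to_{\#}y_i$ for one index $i$ and $x_j=y_j$ for $j\neq i$. For configurations, $C\leq_{\#}D$ iff $C$ can be obtained from $D$ by a (possibly empty) sequence of internal superseding steps, i.e. $C=(p,y_1,\ldots,y_m)$, $D=(p,x_1,\ldots,x_m)$ and $x_i\to_{\#}^*y_i$ for all $i$. A quasi-order $(A,\leq_A)$ is a well-quasi-order if every infinite sequence $x_0,x_1,\ldots$ over $A$ has indices $i<j$ with $x_i\leq_A x_j$. -}

module Defs where

open import Data.Fin.Base using (Fin)
open import Data.List.Base using (List; _∷_; [_]; _++_)
open import Data.Nat.Base using (ℕ; suc; _<_)
open import Data.Product.Base using (∃-syntax; _×_; _,_)
open import Data.Vec.Base using (Vec; lookup)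
open import Function.Bundles using (_↔_)
open import Level using (Level; _⊔_; 0ℓ)
open import Relation.Binary.Core using (Rel)
open import Relation.Binary.Construct.Closure.ReflexiveTransitive using (Star)
open import Relation.Binary.Construct.Closure.Transitive using (TransClosure)
open import Relation.Binary.PropositionalEquality.Core using (_≡_; _≢_)
open import Relation.Binary.Structures using (IsPreorder)
open import Relation.Unary using (Pred)
import Data.Fin.Base as Fin

private
  variable
    a ℓ₁ ℓ₂ : Level

record IsWellQuasiOrder {A : Set a} (_≤_ : Rel A ℓ₁) : Set (a ⊔ ℓ₁) where
  field
    isQuasiOrder : IsPreorder _≡_ _≤_
    good         : (x : ℕ → A) → ∃[ i ] ∃[ j ] (i < j × x i ≤ x j)

StutteringCompatible : {A : Set a} → Rel A ℓ₁ → Rel A ℓ₂ → Set (a ⊔ ℓ₁ ⊔ ℓ₂)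
StutteringCompatible _⟶_ _≤_ =
  ∀ {C D C′} → C ⟶ D → C ≤ C′ → ∃[ D′ ] (TransClosure _⟶_ C′ D′ × D ≤ D′)

record IsStutteringWSTS {A : Set a} (_⟶_ : Rel A ℓ₁) (_≤_ : Rel A ℓ₂)
                        : Set (a ⊔ ℓ₁ ⊔ ℓ₂) where
  field
    isWellQuasiOrder : IsWellQuasiOrder _≤_
    compatible       : StutteringCompatible _⟶_ _≤_

-- Priorities 0, …, d, hence d + 1 letters.
Letter : ℕ → Set
Letter d = Fin (suc d)

Word : ℕ → Set
Word d = List (Letter d)

infix 4 _→#ʷ_

data _→#ʷ_ {d : ℕ} : Rel (Word d) 0ℓ where
  supersede : ∀ u {a b} v → a Fin.≤ b → (u ++ a ∷ b ∷ v) →#ʷ (u ++ b ∷ v)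

data Action : Set where
  write read : Action

record PCS (d : ℕ) : Set₁ where
  field
    m        : ℕ
    Q        : Set
    Q-finite : ∃[ n ] (Q ↔ Fin n)
    Δ        : Pred (Q × Fin m × Action × Letter d × Q) 0ℓ

module Semantics {d : ℕ} (S : PCS d) where
  open PCS S

  Conf : Set
  Conf = Q × Vec (Word d) m

  AgreeExceptAt : Fin m → Rel (Vec (Word d) m) 0ℓ
  AgreeExceptAt i x y = ∀ j → j ≢ i → lookup x j ≡ lookup y j

  infix 4 _→rel_ _→int_ _→#_ _≤#_

  data _→rel_ : Rel Conf 0ℓ where
    reading : ∀ {q q′ i a x y} → Δ (q , i , read , a , q′) →
              lookup x i ≡ a ∷ lookup y i → AgreeExceptAt i x y →
              (q , x) →rel (q′ , y)
    writing : ∀ {q q′ i a x y} → Δ (q , i , write , a , q′) →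
              lookup y i ≡ lookup x i ++ [ a ] → AgreeExceptAt i x y →
              (q , x) →rel (q′ , y)

  data _→int_ : Rel Conf 0ℓ where
    internal : ∀ {q i x y} → lookup x i →#ʷ lookup y i → AgreeExceptAt i x y →
               (q , x) →int (q , y)

  data _→#_ : Rel Conf 0ℓ where
    reliable    : ∀ {C D} → C →rel D → C →# D
    superseding : ∀ {C D} → C →int D → C →# D

  -- The smaller configuration is the one reached by superseding.
  _≤#_ : Rel Conf 0ℓ
  C ≤# D = Star _→int_ D C

{-# OPTIONS --safe #-}
-- Almost-full relations are a constructive form of well-quasi-orders: they
-- are closed under intersection (Ramsey), hence under products, and under
-- Higman's subword embedding.  A word over 0, …, d + 1 is cut at the
-- occurrences of its top letter d + 1 into a first segment, a list of middle
-- segments and a last segment over 0, …, d.  It can be superseded to another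
-- such word as soon as the first and the last segments can, and the middle
-- segments of the target embed into those of the source, since a top letter
-- absorbs everything in front of it.  This gives the well-quasi-order by
-- induction on d.  Compatibility holds because internal steps are steps.
module Submission where

open import Defs
open import Data.Bool.Base using (Bool; true; false)
open import Data.Fin.Base as Fin using (Fin; zero; suc; fromℕ; inject₁)
open import Data.Fin.Properties using (≤fromℕ; toℕ-inject₁)
open import Data.Fin.Relation.Unary.Top using (view; ‵fromℕ; ‵inject₁)
open import Data.List.Base using (List; []; _∷_; _++_; map)
open import Data.List.Relation.Binary.Sublist.Heterogeneous using (Sublist; []; _∷_; _∷ʳ_; minimum)
open import Data.List.Relation.Binary.Sublist.Heterogeneous.Properties using (++⁺; ++ˡ; sublist?)
open import Data.List.Relation.Unary.All using (All; []; _∷_)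
open import Data.List.Relation.Unary.First as First using (first)
open import Data.List.Relation.Unary.First.Properties using (toView)
open import Data.Maybe.Base using (Maybe; just; nothing; is-just)
open import Data.Maybe.Relation.Binary.Pointwise as Maybe using (just; nothing)
open import Data.Nat.Base as ℕ using (ℕ; zero; suc; _<_; z<s; s<s)
open import Data.Product.Base using (∃-syntax; _×_; _,_; proj₁; proj₂)
open import Data.Product.Relation.Binary.Pointwise.NonDependent as Product using (×-decidable)
open import Data.Sum.Base as Sum using (_⊎_; inj₁; inj₂; [_,_])
open import Data.Unit.Base using (⊤; tt)
import Data.Unit.Polymorphic.Base as Unit
open import Data.Vec.Base using (Vec; []; _∷_; lookup; uncons)
open import Data.Vec.Relation.Binary.Pointwise.Inductive as Vec using ([]; _∷_)
open import Function.Base using (_∘_; _on_; id)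
open import Function.Bundles using (Injection)
open import Function.Properties.Inverse using (↔⇒↣)
open import Level using (Level; _⊔_; 0ℓ) renaming (suc to lsuc)
open import Relation.Binary.Construct.Closure.ReflexiveTransitive using (Star; ε; _◅_; _◅◅_; gmap)
open import Relation.Binary.Construct.Closure.Transitive as Transitive using (TransClosure)
open import Relation.Binary.Construct.Intersection using (_∩_)
open import Relation.Binary.Core using (Rel)
open import Relation.Binary.Definitions using (Decidable)
open import Relation.Binary.PropositionalEquality using (_≡_; _≢_; refl; sym; cong; subst₂; isEquivalence)
open import Relation.Nullary.Decidable using (_⊎-dec_; toSum; yes)
open import Relation.Nullary.Negation using (¬_; contradiction)

private
  variable
    a b p q ℓ ℓ₁ ℓ₂ : Level
    A B : Set a
    d n : ℕ

-- Almost-full relations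

-- What is left to find once `x` has been seen: a pair of later terms, or a partner for `x`.
_∪⟨_⟩ : Rel A ℓ → A → Rel A ℓ
(R ∪⟨ x ⟩) y z = R y z ⊎ R x y

-- A derivation is a well-founded tree over finite sequences: `later` reads one more term, and at
-- `now` any two further terms yield a good pair.
data AlmostFull {A : Set a} {ℓ} : Rel A ℓ → Set (a ⊔ lsuc ℓ) where
  now   : {R : Rel A ℓ} → (∀ x y → R x y) → AlmostFull R
  later : {R : Rel A ℓ} → (∀ x → AlmostFull (R ∪⟨ x ⟩)) → AlmostFull R

good-pair : {R : Rel A ℓ} → AlmostFull R → (x : ℕ → A) → ∃[ i ] ∃[ j ] (i < j × R (x i) (x j))
good-pair (now full) x = 0 , 1 , z<s , full (x 0) (x 1)
good-pair (later af) x with good-pair (af (x 0)) (x ∘ suc)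
... | i , j , i<j , inj₁ r = suc i , suc j , s<s i<j , r
-- `x 0` is paired with the earlier of the two terms found.
... | i , j , i<j , inj₂ r = 0 , suc i , z<s , r

preimage : {R : Rel A ℓ₁} {S : Rel B ℓ₂} (f : B → A) →
           (∀ x y → R (f x) (f y) → S x y) → AlmostFull R → AlmostFull S
preimage f R⇒S (now full) = now λ x y → R⇒S x y (full (f x) (f y))
preimage f R⇒S (later af) = later λ x →
  preimage f (λ y z → Sum.map (R⇒S y z) (R⇒S x y)) (af (f x))

weaken : {R : Rel A ℓ₁} {S : Rel A ℓ₂} → (∀ x y → R x y → S x y) → AlmostFull R → AlmostFull S
weaken = preimage id

-- `P` and `Q` depend on no term, so induction on the derivation for `R` suffices: once `R` is full,
-- each `S`-pair gives `T` or both propositions.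
∩-nullary : {R : Rel A ℓ₁} {S : Rel A ℓ₂} {T : Rel A ℓ} {P : Set p} {Q : Set q} →
            AlmostFull R → AlmostFull S →
            (∀ x y → R x y → T x y ⊎ P) → (∀ x y → S x y → T x y ⊎ Q) →
            AlmostFull (λ x y → T x y ⊎ P × Q)
∩-nullary (now full) afS R⇒ S⇒ = weaken
  (λ x y s → [ inj₁ , (λ p → Sum.map₂ (p ,_) (S⇒ x y s)) ] (R⇒ x y (full x y))) afS
∩-nullary (later af) afS R⇒ S⇒ = later λ x → weaken
  (λ y z → λ { (inj₁ (inj₁ t)) → inj₁ (inj₁ t)
             ; (inj₁ (inj₂ t)) → inj₂ (inj₁ t)
             ; (inj₂ pq)       → inj₁ (inj₂ pq) })
  (∩-nullary (af x) afS
    (λ y z → λ { (inj₁ r) → Sum.map₁ inj₁ (R⇒ y z r) ; (inj₂ r) → Sum.map₁ inj₂ (R⇒ x y r) })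
    (λ y z s → Sum.map₁ inj₁ (S⇒ y z s)))

∩-unary : {R : Rel A ℓ₁} {S : Rel A ℓ₂} {T : Rel A ℓ} {P : A → Set p} {Q : A → Set q} →
          AlmostFull R → AlmostFull S →
          (∀ x y → R x y → T x y ⊎ P x) → (∀ x y → S x y → T x y ⊎ Q x) →
          AlmostFull (λ x y → T x y ⊎ P x × Q x)
∩-unary (now full) afS R⇒ S⇒ = weaken
  (λ x y s → [ inj₁ , (λ p → Sum.map₂ (p ,_) (S⇒ x y s)) ] (R⇒ x y (full x y))) afS
∩-unary afR@(later _) (now full) R⇒ S⇒ = weaken
  (λ x y r → [ inj₁ , (λ q → Sum.map₂ (_, q) (R⇒ x y r)) ] (S⇒ x y (full x y))) afR
∩-unary {T = T} {P = P} {Q = Q} afR@(later fR) afS@(later fS) R⇒ S⇒ = later λ x → weaken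
  (λ y z → λ { (inj₁ (inj₁ t))        → inj₁ (inj₁ t)
             ; (inj₁ (inj₂ (inj₁ t))) → inj₂ (inj₁ t)
             ; (inj₁ (inj₂ (inj₂ u))) → inj₁ (inj₂ u)
             ; (inj₂ u)               → inj₂ (inj₂ u) })
  -- With `x` fixed, `P x` and `Q x` are constant, so the nullary case can merge the two inductive
  -- results.
  (∩-nullary {T = λ y z → T y z ⊎ T x y ⊎ P y × Q y}
    (∩-unary {T = λ y z → T y z ⊎ T x y ⊎ P x} (fR x) afS
      (λ y z → λ { (inj₁ r) → Sum.map₁ inj₁ (R⇒ y z r) ; (inj₂ r) → inj₁ (inj₂ (R⇒ x y r)) })
      (λ y z s → Sum.map₁ inj₁ (S⇒ y z s)))
    (∩-unary {T = λ y z → T y z ⊎ T x y ⊎ Q x} afR (fS x)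
      (λ y z r → Sum.map₁ inj₁ (R⇒ y z r))
      (λ y z → λ { (inj₁ s) → Sum.map₁ inj₁ (S⇒ y z s) ; (inj₂ s) → inj₁ (inj₂ (S⇒ x y s)) }))
    (λ _ _ → rearrange) (λ _ _ → rearrange))
  where
  rearrange : ∀ {u v w z} {U : Set u} {V : Set v} {W : Set w} {Z : Set z} →
              (U ⊎ V ⊎ W) ⊎ Z → (U ⊎ V ⊎ Z) ⊎ W
  rearrange (inj₁ (inj₁ u))        = inj₁ (inj₁ u)
  rearrange (inj₁ (inj₂ (inj₁ v))) = inj₁ (inj₂ (inj₁ v))
  rearrange (inj₁ (inj₂ (inj₂ w))) = inj₂ w
  rearrange (inj₂ z)               = inj₁ (inj₂ (inj₂ z))

∩-almostFull : {R : Rel A ℓ₁} {S : Rel A ℓ₂} → AlmostFull R → AlmostFull S → AlmostFull (R ∩ S)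
∩-almostFull (now full) afS = weaken (λ x y s → full x y , s) afS
∩-almostFull afR@(later _) (now full) = weaken (λ x y r → r , full x y) afR
-- After a first term `x`, `R x` and `S x` are predicates of the next term; their conjunction is the
-- new disjunct for `R ∩ S`.
∩-almostFull afR@(later fR) afS@(later fS) = later λ x → ∩-unary
  (∩-almostFull (fR x) afS) (∩-almostFull afR (fS x))
  (λ y z → λ { (inj₁ r , s) → inj₁ (r , s) ; (inj₂ r , s) → inj₂ r })
  (λ y z → λ { (r , inj₁ s) → inj₁ (r , s) ; (r , inj₂ s) → inj₂ s })

×-almostFull : {R : Rel A ℓ₁} {S : Rel B ℓ₂} →
               AlmostFull R → AlmostFull S → AlmostFull (Product.Pointwise R S)
×-almostFull afR afS =
  ∩-almostFull (preimage proj₁ (λ _ _ → id) afR) (preimage proj₂ (λ _ _ → id) afS)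

Bool-almostFull : AlmostFull (_≡_ {A = Bool})
Bool-almostFull = later λ x → later λ y → now λ z w → pigeonhole x y z w
  where
  pigeonhole : (x y z w : Bool) → (z ≡ w ⊎ x ≡ z) ⊎ (y ≡ z ⊎ x ≡ y)
  pigeonhole false false _     _ = inj₂ (inj₂ refl)
  pigeonhole true  true  _     _ = inj₂ (inj₂ refl)
  pigeonhole false true  false _ = inj₁ (inj₂ refl)
  pigeonhole false true  true  _ = inj₂ (inj₁ refl)
  pigeonhole true  false true  _ = inj₁ (inj₂ refl)
  pigeonhole true  false false _ = inj₂ (inj₁ refl)

-- Vacuous unless both sides are `just`; intersecting with equality of shapes recovers the pointwise
-- relation.
OnJust : Rel A ℓ → Rel (Maybe A) ℓ
OnJust R (just x) (just y) = R x y
OnJust R _        _        = Unit.⊤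

OnJust-almostFull : {R : Rel A ℓ} → AlmostFull R → AlmostFull (OnJust R)
OnJust-almostFull (now full) = now λ where
  (just x) (just y) → full x y
  (just x) nothing  → _
  nothing  _        → _
OnJust-almostFull (later af) = later λ where
  nothing  → now λ _ _ → inj₂ _
  (just x) → weaken (λ where
      (just _) (just _) r → r
      (just _) nothing  _ → inj₁ _
      nothing  _        _ → inj₁ _)
    (OnJust-almostFull (af x))

Maybe-almostFull : {R : Rel A ℓ} → AlmostFull R → AlmostFull (Maybe.Pointwise R)
Maybe-almostFull {R = R} af = weaken same-shape
  (∩-almostFull (preimage is-just (λ _ _ → id) Bool-almostFull) (OnJust-almostFull af))
  where
  same-shape : ∀ x y → is-just x ≡ is-just y × OnJust R x y → Maybe.Pointwise R x y
  same-shape (just _) (just _) (_ , r) = just r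
  same-shape nothing  nothing  _       = nothing

Fin-almostFull : ∀ n → AlmostFull (_≡_ {A = Fin n})
Fin-almostFull zero    = now λ ()
Fin-almostFull (suc n) = preimage predecessor predecessor-injective (Maybe-almostFull (Fin-almostFull n))
  where
  predecessor : Fin (suc n) → Maybe (Fin n)
  predecessor zero    = nothing
  predecessor (suc i) = just i

  predecessor-injective : ∀ i j → Maybe.Pointwise _≡_ (predecessor i) (predecessor j) → i ≡ j
  predecessor-injective zero    zero    _          = refl
  predecessor-injective (suc _) (suc _) (just i≡j) = cong suc i≡j

Vec-almostFull : {R : Rel A ℓ} → AlmostFull R → ∀ n → AlmostFull (λ (xs ys : Vec A n) → Vec.Pointwise R xs ys)
Vec-almostFull af zero    = now λ { [] [] → [] }
Vec-almostFull af (suc n) = preimage uncons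
  (λ { (_ ∷ _) (_ ∷ _) (r , rs) → r ∷ rs })
  (×-almostFull af (Vec-almostFull af n))

-- Higman's lemma

module _ {A : Set a} {R : Rel A ℓ} where

  data Cut (x : A) : List A → List A × Maybe (A × List A) → Set (a ⊔ ℓ) where
    avoids : ∀ {u} → All (λ y → ¬ R x y) u → Cut x u (u , nothing)
    hits   : ∀ {u y v} → All (λ y → ¬ R x y) u → R x y → Cut x (u ++ y ∷ v) (u , just (y , v))

  cut : Decidable R → ∀ x u → ∃[ c ] Cut x u c
  cut R? x u with first (Sum.swap ∘ toSum ∘ R? x) u
  ... | inj₂ avoid = _ , avoids avoid
  ... | inj₁ hit with toView hit
  ...   | avoid First.++ r ∷ v = _ , hits avoid r

  -- Avoidance is a hypothesis inside the relation, which thus lives on all words rather than on a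
  -- subtype.
  AvoidingSublist : A → Rel (List A) (a ⊔ ℓ)
  AvoidingSublist x u v = All (λ y → ¬ R x y) u → All (λ y → ¬ R x y) v → Sublist R u v

  -- The extra disjunct of `R ∪⟨ x ⟩` would relate `x` to a letter of `u`, which avoidance excludes.
  avoiding-sublist : ∀ x u v → Sublist (R ∪⟨ x ⟩) u v → AvoidingSublist x u v
  avoiding-sublist x _       _       []           _         _         = []
  avoiding-sublist x u       (_ ∷ v) (y ∷ʳ s)     ¬us       (_ ∷ ¬vs) = y ∷ʳ avoiding-sublist x u v s ¬us ¬vs
  avoiding-sublist x (_ ∷ u) (_ ∷ v) (inj₁ r ∷ s) (_ ∷ ¬us) (_ ∷ ¬vs) = r ∷ avoiding-sublist x u v s ¬us ¬vs
  avoiding-sublist x _       _       (inj₂ r ∷ s) (¬r ∷ _)  _         = contradiction r ¬r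

  -- Induction on w: if w = x ∷ w′ does not embed into u, then either all
  -- letters of u avoid x, or w′ does not embed into what follows the first
  -- letter of u above x.
  Sublist-above : Decidable R → AlmostFull R → (∀ x → AlmostFull (AvoidingSublist x)) →
                  ∀ w → AlmostFull (Sublist R ∪⟨ w ⟩)
  Sublist-above R? af avoiding []      = now λ u _ → inj₂ (minimum u)
  Sublist-above R? af avoiding (x ∷ w) = preimage (proj₁ ∘ cut R? x)
    (λ u v → glue (proj₂ (cut R? x u)) (proj₂ (cut R? x v)))
    (×-almostFull (avoiding x)
      (Maybe-almostFull (×-almostFull af (Sublist-above R? af avoiding w))))
    where
    glue : ∀ {u v c c′} → Cut x u c → Cut x v c′ →
           Product.Pointwise (AvoidingSublist x)
             (Maybe.Pointwise (Product.Pointwise R (Sublist R ∪⟨ w ⟩))) c c′ →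
           (Sublist R ∪⟨ x ∷ w ⟩) u v
    glue (avoids ¬u)         (avoids ¬v) (s , _)                  = inj₁ (s ¬u ¬v)
    glue (hits ¬u _)         (hits ¬v _) (s , just (r , inj₁ s′)) = inj₁ (++⁺ (s ¬u ¬v) (r ∷ s′))
    glue (hits {u = u} _ xRy) _          (_ , just (_ , inj₂ s′)) = inj₂ (++ˡ u (xRy ∷ s′))

-- Induction on the derivation for `R`: words avoiding `x` are handled by the subderivation for
-- `R ∪⟨ x ⟩`, and if `R` is full only the empty word avoids `x`.
Sublist-almostFull : {R : Rel A ℓ} → Decidable R → AlmostFull R → AlmostFull (Sublist R)
Sublist-almostFull R? (now full) = later (Sublist-above R? (now full) λ x → now λ where
  []      v _        _ → minimum v
  (y ∷ _) _ (¬r ∷ _) _ → contradiction (full x y) ¬r)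
Sublist-almostFull R? (later af) = later (Sublist-above R? (later af) λ x →
  weaken (avoiding-sublist x)
    (Sublist-almostFull (λ y z → R? y z ⊎-dec R? x y) (af x)))

-- Superseding on words

_→#ʷ*_ : Rel (Word d) 0ℓ
_→#ʷ*_ = Star _→#ʷ_

∷-→#ʷ : ∀ (c : Letter d) {x y} → x →#ʷ y → (c ∷ x) →#ʷ (c ∷ y)
∷-→#ʷ c (supersede u v a≤b) = supersede (c ∷ u) v a≤b

++ˡ-→#ʷ* : ∀ (w : Word d) {x y} → x →#ʷ* y → (w ++ x) →#ʷ* (w ++ y)
++ˡ-→#ʷ* []      s = s
++ˡ-→#ʷ* (c ∷ w) s = gmap (c ∷_) (∷-→#ʷ c) (++ˡ-→#ʷ* w s)

++ʳ-→#ʷ : ∀ {x y : Word d} w → x →#ʷ y → (x ++ w) →#ʷ (y ++ w)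
++ʳ-→#ʷ w (supersede []      v a≤b) = supersede [] (v ++ w) a≤b
++ʳ-→#ʷ w (supersede (c ∷ u) v a≤b) = ∷-→#ʷ c (++ʳ-→#ʷ w (supersede u v a≤b))

map-inject₁-→#ʷ : {x y : Word d} → x →#ʷ y → map inject₁ x →#ʷ map inject₁ y
map-inject₁-→#ʷ (supersede [] {a} {b} v a≤b) = supersede [] (map inject₁ v)
  (subst₂ ℕ._≤_ (sym (toℕ-inject₁ a)) (sym (toℕ-inject₁ b)) a≤b)
map-inject₁-→#ʷ (supersede (c ∷ u) v a≤b) = ∷-→#ʷ (inject₁ c) (map-inject₁-→#ʷ (supersede u v a≤b))

-- The letters of `w` vanish from right to left, so each stands directly before `t` when it goes.
absorb : ∀ {t : Letter d} → (∀ c → c Fin.≤ t) → ∀ w v → (w ++ t ∷ v) →#ʷ* (t ∷ v)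
absorb ≤t []      v = ε
absorb ≤t (c ∷ w) v = ++ˡ-→#ʷ* (c ∷ []) (absorb ≤t w v) ◅◅ supersede [] v (≤t c) ◅ ε

-- A subrelation of →#ʷ* suffices, and one built from the segments comes with
-- the decision procedure that Higman's lemma requires.
record WordOrder (d : ℕ) : Set₁ where
  field
    _≼_        : Rel (Word d) 0ℓ
    _≼?_       : Decidable _≼_
    almostFull : AlmostFull _≼_
    sound      : ∀ x y → x ≼ y → y →#ʷ* x

-- Segments are given by codes in `X`, so that the base case and the induction step on `d` share one
-- construction.
module Segmentation {X : Set} (⟦_⟧ : X → Word d) {top : Letter d} where

  joinLast : List X → X → Word d
  joinLast []       l = ⟦ l ⟧
  joinLast (x ∷ xs) l = ⟦ x ⟧ ++ top ∷ joinLast xs l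

  join : X × Maybe (List X × X) → Word d
  join (x , nothing)       = ⟦ x ⟧
  join (x , just (xs , l)) = ⟦ x ⟧ ++ top ∷ joinLast xs l

  -- Built from the right: `top` opens an empty first segment and makes the old first one a middle
  -- segment, or the last if no `top` came before; other letters extend the first segment.
  segment : ∃[ e ] ⟦ e ⟧ ≡ [] → (∀ c → c ≡ top ⊎ (∀ x → ∃[ y ] ⟦ y ⟧ ≡ c ∷ ⟦ x ⟧)) →
            ∀ w → ∃[ s ] join s ≡ w
  segment (e , ⟦e⟧≡[]) letter [] = (e , nothing) , ⟦e⟧≡[]
  segment (e , ⟦e⟧≡[]) letter (c ∷ w) with letter c | segment (e , ⟦e⟧≡[]) letter w
  ... | inj₁ refl | (x , nothing)       , refl = (e , just ([] , x))     , cong (_++ top ∷ ⟦ x ⟧) ⟦e⟧≡[]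
  ... | inj₁ refl | (x , just (xs , l)) , refl = (e , just (x ∷ xs , l)) , cong (_++ top ∷ joinLast (x ∷ xs) l) ⟦e⟧≡[]
  ... | inj₂ cons | (x , nothing)       , refl with cons x
  ...   | y , ⟦y⟧≡ = (y , nothing) , ⟦y⟧≡
  segment (e , ⟦e⟧≡[]) letter (c ∷ w) | inj₂ cons | (x , just (xs , l)) , refl with cons x
  ...   | y , ⟦y⟧≡ = (y , just (xs , l)) , cong (_++ top ∷ joinLast xs l) ⟦y⟧≡

  module _ (≤top : ∀ (c : Letter d) → c Fin.≤ top) (_≼_ : Rel X 0ℓ) (sound : ∀ x y → x ≼ y → ⟦ y ⟧ →#ʷ* ⟦ x ⟧) where

    ++-sound : ∀ {x y v w} → x ≼ y → w →#ʷ* v → (⟦ y ⟧ ++ w) →#ʷ* (⟦ x ⟧ ++ v)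
    ++-sound {x} {y} {w = w} x≼y s =
      gmap (_++ w) (++ʳ-→#ʷ w) (sound x y x≼y) ◅◅ ++ˡ-→#ʷ* ⟦ x ⟧ s

    -- The leading `top` carries the induction: a skipped segment and the `top` before it are
    -- absorbed by the `top` after it.
    joinLast-sound : ∀ {xs ys l k} → Sublist _≼_ xs ys → l ≼ k →
                     (top ∷ joinLast ys k) →#ʷ* (top ∷ joinLast xs l)
    joinLast-sound []        l≼k = ++ˡ-→#ʷ* (top ∷ []) (sound _ _ l≼k)
    joinLast-sound (y ∷ʳ s)  l≼k = absorb ≤top (top ∷ ⟦ y ⟧) _ ◅◅ joinLast-sound s l≼k
    joinLast-sound (x≼y ∷ s) l≼k = ++ˡ-→#ʷ* (top ∷ []) (++-sound x≼y (joinLast-sound s l≼k))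

    SegmentOrder : Rel (X × Maybe (List X × X)) 0ℓ
    SegmentOrder = Product.Pointwise _≼_ (Maybe.Pointwise (Product.Pointwise (Sublist _≼_) _≼_))

    join-sound : ∀ s t → SegmentOrder s t → join t →#ʷ* join s
    join-sound _ _ (x≼y , nothing)        = sound _ _ x≼y
    join-sound _ _ (x≼y , just (s , l≼k)) = ++-sound x≼y (joinLast-sound s l≼k)

    wordOrder-from : (∀ w → ∃[ s ] join s ≡ w) → Decidable _≼_ → AlmostFull _≼_ → WordOrder d
    wordOrder-from segments _≼?_ af = record
      { _≼_        = SegmentOrder on proj₁ ∘ segments
      ; _≼?_       = λ x y → ×-decidable _≼?_ (Maybe.dec (×-decidable (sublist? _≼?_) _≼?_)) _ _
      ; almostFull = preimage (proj₁ ∘ segments) (λ _ _ → id)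
          (×-almostFull af (Maybe-almostFull (×-almostFull (Sublist-almostFull _≼?_ af) af)))
      ; sound      = λ x y x≼y → subst₂ _→#ʷ*_ (proj₂ (segments y)) (proj₂ (segments x))
          (join-sound _ _ x≼y)
      }

wordOrder : ∀ d → WordOrder d
-- Over the single letter 0 every letter is `top` and all segments are empty, so one code suffices.
wordOrder zero = wordOrder-from ≤fromℕ (λ _ _ → ⊤) (λ _ _ _ → ε)
  (segment (tt , refl) λ { zero → inj₁ refl }) (λ _ _ → yes tt) (now λ _ _ → tt)
  where open Segmentation (λ (_ : ⊤) → [])
wordOrder (suc d) = wordOrder-from ≤fromℕ _≼_ (λ x y → gmap (map inject₁) map-inject₁-→#ʷ ∘ sound x y)
  (segment ([] , refl) letter) _≼?_ almostFull
  where
  open WordOrder (wordOrder d)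
  open Segmentation (map inject₁)

  letter : ∀ c → c ≡ fromℕ (suc d) ⊎ (∀ (x : Word d) → ∃[ y ] map inject₁ y ≡ c ∷ map inject₁ x)
  letter c with view c
  ... | ‵fromℕ     = inj₁ refl
  ... | ‵inject₁ i = inj₂ λ x → i ∷ x , refl

-- Configurations

-- Internal steps without the control state and for any number of channels, which permits induction
-- on that number.
ChannelStep : Rel (Vec (Word d) n) 0ℓ
ChannelStep x y = ∃[ i ] (lookup x i →#ʷ lookup y i × (∀ j → j ≢ i → lookup x j ≡ lookup y j))

channel-steps : {x y : Vec (Word d) n} → Vec.Pointwise _→#ʷ*_ x y → Star ChannelStep x y
channel-steps []                        = ε
channel-steps (_∷_ {y = w} {xs = xs} s ss) =
  gmap (_∷ xs) (λ r → zero , r , λ { zero 0≢0 → contradiction refl 0≢0 ; (suc _) _ → refl }) s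
  ◅◅
  gmap (w ∷_) (λ { (i , r , agree) → suc i , r , λ { zero _ → refl ; (suc j) j≢i → agree j (j≢i ∘ cong suc) } })
    (channel-steps ss)

module _ (S : PCS d) where
  open PCS S
  open Semantics S

  ≤#-good : (C : ℕ → Conf) → ∃[ i ] ∃[ j ] (i < j × C i ≤# C j)
  ≤#-good = good-pair (weaken Conf-sound
    (×-almostFull
      (preimage (Injection.to Q↣Fin) (λ _ _ → Injection.injective Q↣Fin) (Fin-almostFull _))
      (Vec-almostFull almostFull m)))
    where
    open WordOrder (wordOrder d)
    Q↣Fin = ↔⇒↣ (proj₂ Q-finite)

    Conf-sound : ∀ C D → Product.Pointwise _≡_ (Vec.Pointwise _≼_) C D → C ≤# D
    Conf-sound (q , x) (_ , y) (refl , x≼y) =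
      gmap (q ,_) (λ { (i , s , agree) → internal s agree })
        -- `C ≤# D` is a run from `D` down to `C`, hence the reversal.
        (channel-steps (Vec.sym (λ {w} {w′} → sound w w′) x≼y))

  ≤#-isWellQuasiOrder : IsWellQuasiOrder _≤#_
  ≤#-isWellQuasiOrder = record
    { isQuasiOrder = record
      { isEquivalence = isEquivalence
      ; reflexive     = λ { refl → ε }
      ; trans         = λ C≤D D≤E → D≤E ◅◅ C≤D
      }
    ; good = ≤#-good
    }

  →int*-→# : ∀ {C D E} → Star _→int_ C D → D →# E → TransClosure _→#_ C E
  →int*-→# ε        D→E = Transitive.[ D→E ]
  →int*-→# (s ◅ ss) D→E = superseding s Transitive.∷ →int*-→# ss D→E

theorem2p12 : ∀ (d : ℕ) (S : PCS d) → IsStutteringWSTS (Semantics._→#_ S) (Semantics._≤#_ S)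
theorem2p12 d S = record
  { isWellQuasiOrder = ≤#-isWellQuasiOrder S
  -- `C′` first supersedes down to `C`, then makes the given step, so `D` itself is the witness.
  ; compatible       = λ {_} {D} C→D C≤C′ → D , →int*-→# S C≤C′ C→D , ε
  }
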